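{- For every integer $k\ge 1$, $f(2,k)\le \frac{7}{4}k$.
   Context: An $r$-partite hypergraph is a hypergraph whose vertex set is partitioned into $r$ sides such that every edge contains exactly one vertex from each side (for $r=2$ this is a bipartite graph). A matching is a set of pairwise disjoint edges. Given (not necessarily distinct) sets of edges $F_1,\dots,F_k$, a rainbow matching is a choice of edges $e_1\in F_1,\dots,e_k\in F_k$ with $e_i\cap e_j=\emptyset$ for all $i\neq j$. For positive integers $r,k$, $f(r,k)$ denotes the least number $t$ such that every $k$ (not necessarily distinct) matchings of size $t$ in an $r$-partite hypergraph have a rainbow matching. -}

module Defs where

open import Data.Fin using (Fin)
open import Data.Fin.Subset using (Subset; _∈_; _∩_; Empty)
open import Data.List using (List; length)
open import Data.List.Membership.Propositional using () renaming (_∈_ to _∈ˡ_)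
open import Data.List.Relation.Binary.Subset.Propositional using (_⊆_)
open import Data.List.Relation.Unary.All using (All)
open import Data.List.Relation.Unary.AllPairs using (AllPairs)
open import Data.List.Relation.Unary.Unique.Propositional using (Unique)
open import Data.Nat using (ℕ; _≤_)
open import Data.Product using (_×_; ∃; ∃!)
open import Relation.Binary.PropositionalEquality using (_≡_; _≢_)

-- The sides are the fibres of `side`.  The list `edges` is read as a set:
-- order and repetitions carry no information.
record PartiteHypergraph (r : ℕ) : Set where
  field
    order   : ℕ
    side    : Fin order → Fin r
    edges   : List (Subset order)
    partite : All (λ e → ∀ (i : Fin r) → ∃! _≡_ (λ v → v ∈ e × side v ≡ i)) edges

open PartiteHypergraph public

Disjoint : ∀ {n} → Subset n → Subset n → Set
Disjoint e e′ = Empty (e ∩ e′)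

-- `unique` makes the length of the list the cardinality of the set of edges
-- it represents.
record IsMatchingOfSize {r : ℕ} (H : PartiteHypergraph r) (t : ℕ)
                        (M : List (Subset (order H))) : Set where
  field
    inEdges  : M ⊆ edges H
    unique   : Unique M
    disjoint : AllPairs Disjoint M
    size     : length M ≡ t

record RainbowMatching {n k : ℕ} (F : Fin k → List (Subset n)) : Set where
  field
    choice   : Fin k → Subset n
    chosen   : ∀ i → choice i ∈ˡ F i
    disjoint : ∀ {i j} → i ≢ j → Disjoint (choice i) (choice j)

ForcesRainbow : (r k t : ℕ) → Set
ForcesRainbow r k t =
  (H : PartiteHypergraph r) (F : Fin k → List (Subset (order H))) →
  (∀ i → IsMatchingOfSize H t (F i)) → RainbowMatching F

IsLeast : (ℕ → Set) → ℕ → Set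
IsLeast P t = P t × (∀ s → P s → t ≤ s)

-- The graph of the partial function f: `f[ r , k ]≡ t` says that f(r,k) is
-- defined and equal to t.  A total function would need a proof that a least
-- t exists.
f[_,_]≡_ : (r k t : ℕ) → Set
f[ r , k ]≡ t = IsLeast (ForcesRainbow r k) t

{-# OPTIONS --safe #-}
module Submission where

-- Let m = k - 1.  By induction on k the colours 1, …, m have a rainbow matching with edges x_i y_i;
-- suppose that it cannot be modified into one which also uses the colour 0.  Call a vertex free
-- when it is not covered by the x_i y_i.  Let L be the set of i such that F_0 has an edge from x_i
-- to a free vertex b_i; every edge of F_0 with a free right end is of this kind, so |L| ≥ t - m.
-- For i ∈ L, F_i has at most one edge between free vertices, and that edge ends in b_i, because
-- x_i y_i could be replaced with x_i b_i.  Hence at least t - m - 1 edges of F_i go from some x_j to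
-- a free vertex other than b_i (write N i j), and at least t - m - 1 go from a free vertex to some
-- y_j (write Q i j).  If both N i j and Q j i hold, then replacing x_i y_i and x_j y_j with x_i b_i
-- (colour 0), the edge of F_i at x_j and the edge of F_j at y_i yields a full rainbow matching.
-- So N and the transpose of Q are disjoint in an m × m square, whence
-- 2 (t - m) (t - m - 1) ≤ m², which is false when 4t ≥ 7k - 3.
--
-- The least t is found by search.  Whether t forces a rainbow matching is decidable because the
-- kt edges touch at most kt vertices on each side.

import Algebra.Properties.Semiring.Sum as SemiringSum
open import Data.Bool using (if_then_else_)
open import Data.Fin
  using (Fin; zero; suc; _≟_; toℕ; cast; join; splitAt; combine; remQuot; _↑ˡ_; _↑ʳ_)
open import Data.Fin.Properties
  using (any?; all?; suc-injective; toℕ-injective; toℕ-cast; injective⇒≤; splitAt-join; remQuot-combine;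
         ↑ˡ-injective; ↑ʳ-injective; splitAt-↑ˡ; splitAt-↑ʳ)
open import Data.Fin.Subset using (Subset; _∈_; _∪_; ⁅_⁆)
open import Data.Fin.Subset.Properties
  using (x∈⁅x⁆; x∈⁅y⁆⇒x≡y; x∈p∪q⁺; x∈p∪q⁻; x∈p∩q⁺; x∈p∩q⁻)
open import Data.List using (List; length) renaming (tabulate to tabulateˡ)
import Data.List as List
open import Data.List.Membership.Propositional using () renaming (_∈_ to _∈ˡ_)
open import Data.List.Membership.Propositional.Properties using (∈-lookup; ∈-tabulate⁺; ∈-tabulate⁻)
open import Data.List.Properties using (length-tabulate)
import Data.List.Relation.Unary.All as All
import Data.List.Relation.Unary.All.Properties as All
open import Data.List.Relation.Unary.AllPairs using (AllPairs; _∷_)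
import Data.List.Relation.Unary.AllPairs.Properties as AllPairs
open import Data.Nat
  using (ℕ; zero; suc; _+_; _*_; _∸_; _/_; _%_; _≤_; _<_; z≤n; NonZero; pred)
open import Data.Nat.DivMod using (m≡m%n+[m/n]*n; m%n<n; m/n*n≤m)
open import Data.Nat.Properties hiding (_≟_; suc-injective)
open import Data.Nat.Tactic.RingSolver using (solve-∀)
open import Data.Product using (∃; ∃!; _×_; _,_; proj₁; proj₂; swap; uncurry)
open import Data.Sum using (_⊎_; inj₁; inj₂; [_,_]′)
open import Data.Sum.Properties using (inj₁-injective)
open import Data.Vec using (Vec; []; _∷_; lookup; tabulate)
import Data.Vec.Functional as Vector
open import Data.Vec.Functional.Properties using (updateAt-updates; updateAt-minimal)
open import Data.Vec.Properties using (lookup∘tabulate)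
open import Function using (_∘_; const; Injective)
open import Relation.Binary using (Symmetric)
open import Relation.Binary.PropositionalEquality
open import Relation.Nullary using (¬_; Dec; yes; no; does; contradiction)
open import Relation.Nullary.Decidable using (map′; ¬?; _×-dec_; _→-dec_; _⊎-dec_; decidable-stable)
open import Relation.Unary using (Decidable)
open import Defs

private
  variable
    k m n t : ℕ

-- Counting and pigeonhole over finite index sets.

open SemiringSum +-*-semiring using (sum; sum-cong-≗; ∑-comm; ∑-distrib-+; *-distribʳ-sum)

sum-mono : {f g : Fin n → ℕ} → (∀ i → f i ≤ g i) → sum f ≤ sum g
sum-mono {zero}  f≤g = z≤n
sum-mono {suc n} f≤g = +-mono-≤ (f≤g zero) (sum-mono (f≤g ∘ suc))

sum-≤-const : ∀ {b} {f : Fin n → ℕ} → (∀ i → f i ≤ b) → sum f ≤ n * b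
sum-≤-const {zero}  f≤b = z≤n
sum-≤-const {suc n} f≤b = +-mono-≤ (f≤b zero) (sum-≤-const (f≤b ∘ suc))

indicator : ∀ {A : Set} → Dec A → ℕ
indicator A? = if does A? then 1 else 0

count : {P : Fin n → Set} → Decidable P → ℕ
count P? = sum (λ i → indicator (P? i))

rank : {P : Fin n → Set} (P? : Decidable P) → ∀ {i} → P i → Fin (count P?)
rank P? {zero} p with P? zero
... | yes _ = zero
... | no ¬p = contradiction p ¬p
rank P? {suc i} p with P? zero
... | yes _ = suc (rank (P? ∘ suc) p)
... | no  _ = rank (P? ∘ suc) p

rank-injective : {P : Fin n → Set} (P? : Decidable P) → ∀ {i j} (p : P i) (q : P j) →
                 rank P? p ≡ rank P? q → i ≡ j
rank-injective P? {zero} {zero} p q eq = refl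
rank-injective P? {zero} {suc j} p q eq with P? zero
rank-injective P? {zero} {suc j} p q () | yes _
... | no ¬p = contradiction p ¬p
rank-injective P? {suc i} {zero} p q eq with P? zero
rank-injective P? {suc i} {zero} p q () | yes _
... | no ¬q = contradiction q ¬q
rank-injective P? {suc i} {suc j} p q eq with P? zero
... | yes _ = cong suc (rank-injective (P? ∘ suc) p q (suc-injective eq))
... | no  _ = cong suc (rank-injective (P? ∘ suc) p q eq)

-- Pigeonhole: each `p` is charged to an element of `P` or to one of `n` slots, and neither `R` nor
-- `S` lets two `p` share a target. Applied to the t edges of one matching, with exceptional
-- vertices as slots.
covered⇒≤ : {P : Fin m → Set} (P? : Decidable P) {R : Fin t → Fin m → Set} {S : Fin t → Fin n → Set} →
            (∀ {p q j} → R p j → R q j → p ≡ q) → (∀ {p q j} → S p j → S q j → p ≡ q) →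
            (∀ p → (∃ λ j → P j × R p j) ⊎ ∃ (S p)) → t ≤ count P? + n
covered⇒≤ {m} {t} {n} {P} P? {R} {S} R-inj S-inj cover = injective⇒≤ code-injective
  where
  slot : ∀ {p} → (∃ λ j → P j × R p j) ⊎ ∃ (S p) → Fin (count P?) ⊎ Fin n
  slot (inj₁ (j , Pj , _)) = inj₁ (rank P? Pj)
  slot (inj₂ (j , _))      = inj₂ j

  slot-injective : ∀ {p q} (u : (∃ λ j → P j × R p j) ⊎ ∃ (S p)) (v : (∃ λ j → P j × R q j) ⊎ ∃ (S q)) →
                   slot u ≡ slot v → p ≡ q
  slot-injective (inj₁ (i , Pi , Rpi)) (inj₁ (j , Pj , Rqj)) eq
    with refl ← rank-injective P? Pi Pj (inj₁-injective eq) = R-inj Rpi Rqj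
  slot-injective (inj₂ (i , Spi)) (inj₂ (j , Sqj)) refl = S-inj Spi Sqj

  code : Fin t → Fin (count P? + n)
  code p = join _ _ (slot (cover p))

  code-injective : Injective _≡_ _≡_ code
  code-injective {p} {q} eq = slot-injective (cover p) (cover q) (begin
    slot (cover p)         ≡⟨ splitAt-join _ n (slot (cover p)) ⟨
    splitAt _ (code p)     ≡⟨ cong (splitAt _) eq ⟩
    splitAt _ (code q)     ≡⟨ splitAt-join _ n (slot (cover q)) ⟩
    slot (cover q)         ∎)
    where open ≡-Reasoning

indicator-exclusive : ∀ {A B : Set} (A? : Dec A) (B? : Dec B) → (A → ¬ B) →
                      indicator A? + indicator B? ≤ 1
indicator-exclusive (yes a) (yes b) excl = contradiction b (excl a)
indicator-exclusive (yes a) (no ¬b) excl = ≤-refl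
indicator-exclusive (no ¬a) (yes b) excl = ≤-refl
indicator-exclusive (no ¬a) (no ¬b) excl = z≤n

count-≤ : {P : Fin n → Set} (P? : Decidable P) → count P? ≤ n
count-≤ {n} P? = subst (count P? ≤_) (*-identityʳ n) (sum-≤-const (indicator-≤-1 ∘ P?))
  where
  indicator-≤-1 : ∀ {A : Set} (A? : Dec A) → indicator A? ≤ 1
  indicator-≤-1 (yes _) = ≤-refl
  indicator-≤-1 (no _)  = z≤n

-- Transposing the second sum puts both counts on one m × m grid, where each cell contributes at
-- most 1.
count-exclusive : {N Q : Fin m → Fin m → Set} (N? : ∀ i → Decidable (N i)) (Q? : ∀ i → Decidable (Q i)) →
                  (∀ {i j} → N i j → ¬ Q j i) →
                  sum (λ i → count (N? i)) + sum (λ j → count (Q? j)) ≤ m * m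
count-exclusive {m} N? Q? excl = begin
  sum (λ i → count (N? i)) + sum (λ j → count (Q? j))
    ≡⟨ cong (sum (λ i → count (N? i)) +_) (∑-comm (λ j i → indicator (Q? j i))) ⟩
  sum (λ i → count (N? i)) + sum (λ i → sum (λ j → indicator (Q? j i)))
    ≡⟨ ∑-distrib-+ (λ i → count (N? i)) _ ⟨
  sum (λ i → count (N? i) + sum (λ j → indicator (Q? j i)))
    ≡⟨ sum-cong-≗ (λ i → sym (∑-distrib-+ (λ j → indicator (N? i j)) _)) ⟩
  sum (λ i → sum (λ j → indicator (N? i j) + indicator (Q? j i)))
    ≤⟨ sum-≤-const (λ i → sum-≤-const (λ j → indicator-exclusive (N? i j) (Q? j i) excl)) ⟩
  m * (m * 1)
    ≡⟨ cong (m *_) (*-identityʳ m) ⟩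
  m * m ∎
  where open ≤-Reasoning

count-*-≤ : ∀ {P : Fin m → Set} (P? : Decidable P) {s} {f : Fin m → ℕ} →
            (∀ {i} → P i → s ≤ f i) → count P? * s ≤ sum f
count-*-≤ P? {s} {f} bound = begin
  count P? * s                        ≡⟨ *-distribʳ-sum s (λ i → indicator (P? i)) ⟩
  sum (λ i → indicator (P? i) * s)    ≤⟨ sum-mono (λ i → term (P? i)) ⟩
  sum f                               ∎
  where
  open ≤-Reasoning
  term : ∀ {i} (Pi? : Dec _) → indicator Pi? * s ≤ f i
  term (yes Pi) = ≤-trans (≤-reflexive (*-identityˡ s)) (bound Pi)
  term (no _)   = z≤n

-- Arithmetic of the bound 7k/4.

square-* : ∀ a b → (a * b) * (a * b) ≡ a * a * (b * b)
square-* = solve-∀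

-- Both l and s are at least 3m/4, and 2 (3/4)² > 1.
product-too-big : ∀ {l s} → l ≤ m → s < l → 3 * m ≤ 4 * s → ¬ (2 * (l * s) ≤ m * m)
-- The case s = 0 is separate because 16 s² < 18 s² needs s positive; here 3m ≤ 0 although m ≥ l >
-- 0.
product-too-big {m} {l} {zero}  l≤m s<l 3m≤4s _ = <⇒≱ (*-monoʳ-< 3 (≤-trans s<l l≤m)) 3m≤4s
product-too-big {m} {l} {suc s′} l≤m s<l 3m≤4s = go (suc s′) s<l 3m≤4s
  where
  open ≤-Reasoning
  -- Generalising suc s′ to a variable keeps the products from unfolding.
  go : ∀ s .{{_ : NonZero s}} → s < l → 3 * m ≤ 4 * s → ¬ (2 * (l * s) ≤ m * m)
  go s s<l 3m≤4s 2ls≤m² = <-irrefl refl (begin-strict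
    16 * (s * s)            <⟨ *-monoˡ-< (s * s) {{m*n≢0 s s}} (m≤m+n 17 1) ⟩
    18 * (s * s)            ≤⟨ *-monoʳ-≤ 18 (*-monoˡ-≤ s (<⇒≤ s<l)) ⟩
    18 * (l * s)            ≡⟨ *-assoc 9 2 (l * s) ⟩
    9 * (2 * (l * s))       ≤⟨ *-monoʳ-≤ 9 2ls≤m² ⟩
    9 * (m * m)             ≡⟨ square-* 3 m ⟨
    (3 * m) * (3 * m)       ≤⟨ *-mono-≤ 3m≤4s 3m≤4s ⟩
    (4 * s) * (4 * s)       ≡⟨ square-* 4 s ⟩
    16 * (s * s)            ∎)

-- With k = m + 1, the hypothesis is the integer form of t ≥ ⌊7k/4⌋. The conclusion makes the
-- truncated difference `t ∸ suc m` exact.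
large⇒m<t : ∀ t → 7 * suc m ≤ 4 * t + 3 → m < t
large⇒m<t {m} t large = *-cancelˡ-≤ 4 (+-cancelʳ-≤ 3 (4 * suc m) (4 * t) (begin
  4 * suc m + 3            ≤⟨ m≤m+n _ (3 * m) ⟩
  4 * suc m + 3 + 3 * m    ≡⟨ regroup m ⟩
  7 * suc m                ≤⟨ large ⟩
  4 * t + 3                ∎))
  where
  open ≤-Reasoning
  regroup : ∀ m → 4 * suc m + 3 + 3 * m ≡ 7 * suc m
  regroup = solve-∀

large⇒3m≤4s : ∀ t → 7 * suc m ≤ 4 * t + 3 → 3 * m ≤ 4 * (t ∸ suc m)
large⇒3m≤4s {m} t large = +-cancelʳ-≤ (4 * suc m + 3) (3 * m) (4 * (t ∸ suc m)) (begin
  3 * m + (4 * suc m + 3)              ≡⟨ regroup m ⟩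
  7 * suc m                            ≤⟨ large ⟩
  4 * t + 3                            ≡⟨ cong (λ u → 4 * u + 3) (m∸n+n≡m (large⇒m<t t large)) ⟨
  4 * (t ∸ suc m + suc m) + 3          ≡⟨ distribute (t ∸ suc m) (suc m) ⟩
  4 * (t ∸ suc m) + (4 * suc m + 3)    ∎)
  where
  open ≤-Reasoning
  regroup : ∀ m → 3 * m + (4 * suc m + 3) ≡ 7 * suc m
  regroup = solve-∀
  distribute : ∀ a b → 4 * (a + b) + 3 ≡ 4 * a + (4 * b + 3)
  distribute = solve-∀

-- Injectivity of modified vertex assignments.

-- `S` marks the indices that may change. New values must avoid only old values outside `S`, so a
-- vertex released inside `S` can be reused.
injective-off : {x x′ : Fin m → Fin n} {S : Fin m → Set} → Decidable S → Injective _≡_ _≡_ x →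
                (∀ {l} → ¬ S l → x′ l ≡ x l) →
                (∀ {i j} → S i → S j → x′ i ≡ x′ j → i ≡ j) →
                (∀ {i l} → S i → ¬ S l → x l ≢ x′ i) →
                Injective _≡_ _≡_ x′
injective-off S? x-inj same inj-on fresh {i} {j} eq with S? i | S? j
... | yes Si | yes Sj = inj-on Si Sj eq
... | yes Si | no ¬Sj = contradiction (trans (sym (same ¬Sj)) (sym eq)) (fresh Si ¬Sj)
... | no ¬Si | yes Sj = contradiction (trans (sym (same ¬Si)) eq) (fresh Sj ¬Si)
... | no ¬Si | no ¬Sj = x-inj (trans (sym (same ¬Si)) (trans eq (same ¬Sj)))

injective-cons : {f : Fin (suc m) → Fin n} → Injective _≡_ _≡_ (f ∘ suc) →
                 (∀ i → f (suc i) ≢ f zero) → Injective _≡_ _≡_ f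
injective-cons inj fresh {zero}  {zero}  eq = refl
injective-cons inj fresh {zero}  {suc j} eq = contradiction (sym eq) (fresh j)
injective-cons inj fresh {suc i} {zero}  eq = contradiction eq (fresh i)
injective-cons inj fresh {suc i} {suc j} eq = cong suc (inj eq)

-- One side of an augmented matching: index `zero` is the added colour and index `i` moves to `u`.
-- The added colour may take the released value `x i`.
injective-extend₁ : {x : Fin m → Fin n} (x′ : Fin (suc m) → Fin n) → Injective _≡_ _≡_ x →
                    ∀ {i u} → x′ (suc i) ≡ u → (∀ {l} → l ≢ i → x′ (suc l) ≡ x l) →
                    (∀ {l} → l ≢ i → x l ≢ u) → u ≢ x′ zero → (∀ {l} → l ≢ i → x l ≢ x′ zero) →
                    Injective _≡_ _≡_ x′
injective-extend₁ x′ x-inj {i} refl same new u≢z x≢z = injective-cons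
  (injective-off (_≟ i) x-inj same (λ { refl refl _ → refl }) (λ { refl → new })) ≢z
  where
  ≢z : ∀ l → x′ (suc l) ≢ x′ zero
  ≢z l with l ≟ i
  ... | yes refl = u≢z
  ... | no l≢i   = x≢z l≢i ∘ trans (sym (same l≢i))

injective-extend₂ : {x : Fin m → Fin n} (x′ : Fin (suc m) → Fin n) → Injective _≡_ _≡_ x →
                    ∀ {i j u v} → x′ (suc i) ≡ u → x′ (suc j) ≡ v →
                    (∀ {l} → l ≢ i → l ≢ j → x′ (suc l) ≡ x l) → u ≢ v →
                    (∀ {l} → l ≢ i → l ≢ j → x l ≢ u) → (∀ {l} → l ≢ i → l ≢ j → x l ≢ v) →
                    u ≢ x′ zero → v ≢ x′ zero → (∀ {l} → l ≢ i → l ≢ j → x l ≢ x′ zero) →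
                    Injective _≡_ _≡_ x′
injective-extend₂ {x = x} x′ x-inj {i} {j} refl refl same u≢v newᵤ newᵥ u≢z v≢z x≢z = injective-cons
  (injective-off S? x-inj (λ ¬Sl → same (¬Sl ∘ inj₁) (¬Sl ∘ inj₂)) on new) ≢z
  where
  S : Fin _ → Set
  S l = l ≡ i ⊎ l ≡ j

  S? : Decidable S
  S? l = (l ≟ i) ⊎-dec (l ≟ j)

  on : ∀ {a b} → S a → S b → x′ (suc a) ≡ x′ (suc b) → a ≡ b
  on (inj₁ refl) (inj₁ refl) _  = refl
  on (inj₁ refl) (inj₂ refl) eq = contradiction eq u≢v
  on (inj₂ refl) (inj₁ refl) eq = contradiction (sym eq) u≢v
  on (inj₂ refl) (inj₂ refl) _  = refl

  new : ∀ {a l} → S a → ¬ S l → x l ≢ x′ (suc a)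
  new (inj₁ refl) ¬Sl = newᵤ (¬Sl ∘ inj₁) (¬Sl ∘ inj₂)
  new (inj₂ refl) ¬Sl = newᵥ (¬Sl ∘ inj₁) (¬Sl ∘ inj₂)

  ≢z : ∀ l → x′ (suc l) ≢ x′ zero
  ≢z l with l ≟ i | l ≟ j
  ... | yes refl | _        = u≢z
  ... | no _     | yes refl = v≢z
  ... | no l≢i   | no l≢j   = x≢z l≢i l≢j ∘ trans (sym (same l≢i l≢j))

-- Families of matchings and rainbow choices.

-- A family of k matchings of size t is given by its left and right ends:
-- the p-th edge of the i-th matching joins ℓ i p to r i p.
Ends : ℕ → ℕ → ℕ → Set
Ends k t n = Fin k → Fin t → Fin n

RowInjective : Ends k t n → Set
RowInjective ℓ = ∀ i → Injective _≡_ _≡_ (ℓ i)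

along : Ends k t n → (Fin k → Fin t) → Fin k → Fin n
along ℓ c i = ℓ i (c i)

-- The two sides are separate copies of `Fin n`, so disjointness of the chosen edges is injectivity
-- on each side.
IsRainbow : (ℓ r : Ends k t n) → (Fin k → Fin t) → Set
IsRainbow ℓ r c = Injective _≡_ _≡_ (along ℓ c) × Injective _≡_ _≡_ (along r c)

Rainbow : (ℓ r : Ends k t n) → Set
Rainbow ℓ r = ∃ (IsRainbow ℓ r)

Free : (Fin m → Fin n) → Fin n → Set
Free x v = ¬ ∃ λ i → x i ≡ v

free? : (x : Fin m → Fin n) → Decidable (Free x)
free? x v = ¬? (any? (λ i → x i ≟ v))

-- The augmentation argument.

module Augmentation (ℓ r : Ends (suc m) t n) (ℓ-inj : RowInjective ℓ) (r-inj : RowInjective r)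
                    (c : Fin m → Fin t) (c-rainbow : IsRainbow (ℓ ∘ suc) (r ∘ suc) c)
                    (stuck : ¬ Rainbow ℓ r) where

  x y : Fin m → Fin n
  x = along (ℓ ∘ suc) c
  y = along (r ∘ suc) c

  x-inj : Injective _≡_ _≡_ x
  x-inj = proj₁ c-rainbow

  y-inj : Injective _≡_ _≡_ y
  y-inj = proj₂ c-rainbow

  no-free-edge : ∀ p → Free x (ℓ zero p) → ¬ Free y (r zero p)
  no-free-edge p fx fy = stuck
    ( p Vector.∷ c
    , injective-cons x-inj (λ i eq → fx (i , eq))
    , injective-cons y-inj (λ i eq → fy (i , eq)))

  -- The right end `r zero p` is the vertex b_i of the outline. Carrying `p` as a witness avoids
  -- choosing b_i for i outside `L`.
  Exits : Fin m → Fin t → Set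
  Exits i p = ℓ zero p ≡ x i × Free y (r zero p)

  L : Fin m → Set
  L i = ∃ (Exits i)

  N : Fin m → Fin m → Set
  N i j = ∃ λ p → Exits i p × ∃ λ q → ℓ (suc i) q ≡ x j × Free y (r (suc i) q) × r (suc i) q ≢ r zero p

  Q : Fin m → Fin m → Set
  Q j i = L j × ∃ λ w → Free x (ℓ (suc j) w) × r (suc j) w ≡ y i

  Exits? : ∀ i → Decidable (Exits i)
  Exits? i p = (ℓ zero p ≟ x i) ×-dec free? y (r zero p)

  L? : Decidable L
  L? i = any? (Exits? i)

  N? : ∀ i → Decidable (N i)
  N? i j = any? λ p → Exits? i p ×-dec any? λ q →
    (ℓ (suc i) q ≟ x j) ×-dec (free? y (r (suc i) q) ×-dec ¬? (r (suc i) q ≟ r zero p))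

  Q? : ∀ j → Decidable (Q j)
  Q? j i = L? j ×-dec any? λ w → free? x (ℓ (suc j) w) ×-dec (r (suc j) w ≟ y i)

  -- If the right ends differed, colour 0 could take `p` while colour `suc i` moves to `q`: the move
  -- releases `x i`, and all other new ends are free.
  one-swap : ∀ {i p} → Exits i p → ∀ q → Free x (ℓ (suc i) q) → Free y (r (suc i) q) →
             r (suc i) q ≡ r zero p
  one-swap {i} {p} (x≡ , fy) q fxq fyq = decidable-stable (_ ≟ _) λ b≢ → stuck
    ( p Vector.∷ d
    , injective-extend₁ _ x-inj (cong (ℓ (suc i)) d-i) (same ℓ)
        (λ _ eq → fxq (_ , eq))
        (λ eq → fxq (i , sym (trans eq x≡)))
        (λ l≢i eq → l≢i (x-inj (trans eq x≡)))
    , injective-extend₁ _ y-inj (cong (r (suc i)) d-i) (same r)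
        (λ _ eq → fyq (_ , eq))
        b≢
        (λ _ eq → fy (_ , eq)))
    where
    d : Fin m → Fin t
    d = Vector.updateAt c i (const q)

    d-i : d i ≡ q
    d-i = updateAt-updates i c

    same : (ε : Ends (suc m) t n) → ∀ {l} → l ≢ i → ε (suc l) (d l) ≡ ε (suc l) (c l)
    same ε {l} l≢i = cong (ε (suc l)) (updateAt-minimal l i c l≢i)

  -- In a matching the only edge at `x i` is the one chosen by `c`, and its right end `y i` is not
  -- free.
  N-irreflexive : ∀ {i} → ¬ N i i
  N-irreflexive {i} (_ , _ , q , x≡ , fy , _) with refl ← ℓ-inj (suc i) {q} {c i} x≡ = fy (i , refl)

  -- Colours 0, `suc i` and `suc j` take `p`, `q` and `w`. The left ends `x i` and `x j` pass to the
  -- first two, the right end `y i` to the third; the other new ends are free, and the two free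
  -- right ends differ by `b≢`.
  two-swaps : ∀ {i j} → N i j → ¬ Q j i
  two-swaps {i} {j} (p , (x≡ , fyp) , q , xq≡ , fyq , b≢) (_ , w , fxw , yw≡) = stuck
    ( p Vector.∷ d
    , injective-extend₂ _ x-inj (trans (cong (ℓ (suc i)) d-i) xq≡) (cong (ℓ (suc j)) d-j) (same ℓ)
        (λ eq → fxw (j , eq))
        (λ _ l≢j eq → l≢j (x-inj eq))
        (λ _ _ eq → fxw (_ , eq))
        (λ eq → i≢j (sym (x-inj (trans eq x≡))))
        (λ eq → fxw (i , sym (trans eq x≡)))
        (λ l≢i _ eq → l≢i (x-inj (trans eq x≡)))
    , injective-extend₂ _ y-inj (cong (r (suc i)) d-i) (trans (cong (r (suc j)) d-j) yw≡) (same r)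
        (λ eq → fyq (i , sym eq))
        (λ _ _ eq → fyq (_ , eq))
        (λ l≢i _ eq → l≢i (y-inj eq))
        b≢
        (λ eq → fyp (i , eq))
        (λ _ _ eq → fyp (_ , eq)))
    where
    i≢j : i ≢ j
    i≢j refl = N-irreflexive (p , (x≡ , fyp) , q , xq≡ , fyq , b≢)

    d′ d : Fin m → Fin t
    d′ = Vector.updateAt c i (const q)
    d  = Vector.updateAt d′ j (const w)

    d-i : d i ≡ q
    d-i = trans (updateAt-minimal i j d′ i≢j) (updateAt-updates i c)

    d-j : d j ≡ w
    d-j = updateAt-updates j d′

    same : (ε : Ends (suc m) t n) → ∀ {l} → l ≢ i → l ≢ j → ε (suc l) (d l) ≡ ε (suc l) (c l)
    same ε {l} l≢i l≢j =
      cong (ε (suc l)) (trans (updateAt-minimal l j d′ l≢j) (updateAt-minimal l i c l≢i))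

  -- An edge of colour 0 that misses every `y i` starts at some `x i` by `no-free-edge`; the
  -- vertices `y i` are the m slots.
  L-count : t ≤ count L? + m
  L-count = covered⇒≤ L? {R = λ p i → x i ≡ ℓ zero p} {S = λ p i → y i ≡ r zero p}
    (λ e e′ → ℓ-inj zero (trans (sym e) e′)) (λ e e′ → r-inj zero (trans (sym e) e′)) cover
    where
    cover : ∀ p → (∃ λ i → L i × x i ≡ ℓ zero p) ⊎ ∃ λ i → y i ≡ r zero p
    cover p with any? (λ i → y i ≟ r zero p) | any? (λ i → x i ≟ ℓ zero p)
    ... | yes hit | _              = inj₂ hit
    ... | no fy   | yes (i , x≡)   = inj₁ (i , (p , sym x≡ , fy) , x≡)
    ... | no fy   | no fx          = contradiction fy (no-free-edge p fx)

  -- The m + 1 slots are the right vertices b_i and `y l`. An edge missing all of them starts at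
  -- some `x j`, since `one-swap` sends an edge with both ends free to b_i.
  N-count : ∀ {i} → L i → t ≤ count (N? i) + suc m
  N-count {i} (p , exit) = covered⇒≤ (N? i)
    {R = λ q j → x j ≡ ℓ (suc i) q} {S = λ q j → (r zero p Vector.∷ y) j ≡ r (suc i) q}
    (λ e e′ → ℓ-inj (suc i) (trans (sym e) e′)) (λ e e′ → r-inj (suc i) (trans (sym e) e′)) cover
    where
    cover : ∀ q → (∃ λ j → N i j × x j ≡ ℓ (suc i) q) ⊎ ∃ λ j → (r zero p Vector.∷ y) j ≡ r (suc i) q
    cover q with any? (λ j → (r zero p Vector.∷ y) j ≟ r (suc i) q) | any? (λ j → x j ≟ ℓ (suc i) q)
    ... | yes hit | _            = inj₂ hit
    ... | no miss | yes (j , x≡) = inj₁ (j , (p , exit , q , sym x≡ , fy , λ eq → miss (zero , sym eq)) , x≡)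
      where
      fy : Free y (r (suc i) q)
      fy (l , eq) = miss (suc l , eq)
    ... | no miss | no fx = contradiction (zero , sym (one-swap exit q fx (λ (l , eq) → miss (suc l , eq)))) miss

  Q-count : ∀ {j} → L j → t ≤ count (Q? j) + suc m
  Q-count {j} Lj@(p , exit) = covered⇒≤ (Q? j) {R = λ w i → y i ≡ r (suc j) w} {S = S}
    (λ e e′ → r-inj (suc j) (trans (sym e) e′)) S-inj cover
    where
    -- The slots lie on both sides: `zero` is the right vertex b_j, `suc i` the left vertex `x i`.
    S : Fin t → Fin (suc m) → Set
    S w zero    = r zero p ≡ r (suc j) w
    S w (suc i) = x i ≡ ℓ (suc j) w

    S-inj : ∀ {v w i} → S v i → S w i → v ≡ w
    S-inj {i = zero}  e e′ = r-inj (suc j) (trans (sym e) e′)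
    S-inj {i = suc i} e e′ = ℓ-inj (suc j) (trans (sym e) e′)

    cover : ∀ w → (∃ λ i → Q j i × y i ≡ r (suc j) w) ⊎ ∃ (S w)
    cover w with any? (λ i → x i ≟ ℓ (suc j) w) | any? (λ i → y i ≟ r (suc j) w)
    ... | yes (i , eq) | _            = inj₂ (suc i , eq)
    ... | no fx        | yes (i , y≡) = inj₁ (i , (Lj , w , fx , sym y≡) , y≡)
    ... | no fx        | no fy        = inj₂ (zero , sym (one-swap exit w fx fy))

  count-bound : 2 * (count L? * (t ∸ suc m)) ≤ m * m
  count-bound = begin
    2 * (count L? * s)                                      ≡⟨ cong (count L? * s +_) (+-identityʳ _) ⟩
    count L? * s + count L? * s                             ≤⟨ +-mono-≤ (count-*-≤ L? N-bound) (count-*-≤ L? Q-bound) ⟩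
    sum (λ i → count (N? i)) + sum (λ j → count (Q? j))     ≤⟨ count-exclusive N? Q? two-swaps ⟩
    m * m                                                   ∎
    where
    open ≤-Reasoning
    s : ℕ
    s = t ∸ suc m
    N-bound : ∀ {i} → L i → s ≤ count (N? i)
    N-bound Li = m≤n+o⇒m∸n≤o _ (suc m) (≤-trans (N-count Li) (≤-reflexive (+-comm _ (suc m))))
    Q-bound : ∀ {i} → L i → s ≤ count (Q? i)
    Q-bound Li = m≤n+o⇒m∸n≤o _ (suc m) (≤-trans (Q-count Li) (≤-reflexive (+-comm _ (suc m))))

  impossible : ¬ (7 * suc m ≤ 4 * t + 3)
  impossible large = product-too-big (count-≤ L?) s<l (large⇒3m≤4s t large) count-bound
    where
    open ≤-Reasoning
    -- Strict because `L-count` gives at least t - m, one more than t - m - 1.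
    s<l : t ∸ suc m < count L?
    s<l = +-cancelʳ-≤ m _ _ (begin
      suc (t ∸ suc m) + m    ≡⟨ +-suc (t ∸ suc m) m ⟨
      t ∸ suc m + suc m      ≡⟨ m∸n+n≡m (large⇒m<t t large) ⟩
      t                      ≤⟨ L-count ⟩
      count L? + m           ∎)

-- Decidability by exhaustive search, and the induction on k.

Searchable : Set → Set₁
Searchable A = {P : A → Set} → Decidable P → Dec (∃ P)

search-Vec : ∀ {A} → Searchable A → ∀ n → Searchable (Vec A n)
search-Vec search zero    P? = map′ ([] ,_) (λ { ([] , p) → p }) (P? [])
search-Vec search (suc n) P? = map′ (λ (a , v , p) → a ∷ v , p) (λ { (a ∷ v , p) → a , v , p })
  (search λ a → search-Vec search n (λ v → P? (a ∷ v)))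

∀-dec : ∀ {A} → Searchable A → {P : A → Set} → Decidable P → Dec (∀ a → P a)
∀-dec search P? = map′ (λ none a → decidable-stable (P? a) (λ ¬p → none (a , ¬p)))
  (λ all (a , ¬p) → ¬p (all a)) (¬? (search (¬? ∘ P?)))

injective? : (f : Fin m → Fin n) → Dec (Injective _≡_ _≡_ f)
injective? f = map′ (λ h → h _ _) (λ h _ _ → h)
  (all? λ i → all? λ j → (f i ≟ f j) →-dec (i ≟ j))

injective-≗ : ∀ {A : Set} {f g : Fin m → A} → (∀ i → f i ≡ g i) → Injective _≡_ _≡_ f → Injective _≡_ _≡_ g
injective-≗ f≗g inj {i} {j} eq = inj (trans (f≗g i) (trans eq (sym (f≗g j))))

-- Choices are enumerated as vectors; a function agrees with its tabulation only pointwise, whence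
-- `injective-≗`.
rainbow? : (ℓ r : Ends k t n) → Dec (Rainbow ℓ r)
rainbow? {k} ℓ r = map′ (λ (v , h) → lookup v , h)
  (λ (c , ic , jc) → tabulate c
    , injective-≗ (λ i → cong (ℓ i) (sym (lookup∘tabulate c i))) ic
    , injective-≗ (λ i → cong (r i) (sym (lookup∘tabulate c i))) jc)
  (search-Vec any? k λ v → injective? (along ℓ (lookup v)) ×-dec injective? (along r (lookup v)))

-- Induction on k with t fixed, as `large` passes to smaller k. Decidability of `Rainbow` makes the
-- argument by contradiction constructive.
rainbow-exists : 7 * k ≤ 4 * t + 3 → (ℓ r : Ends k t n) → RowInjective ℓ → RowInjective r → Rainbow ℓ r
rainbow-exists {zero}  large ℓ r ℓ-inj r-inj = (λ ()) , (λ { {()} }) , (λ { {()} })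
rainbow-exists {suc m} large ℓ r ℓ-inj r-inj
  with (c , c-rainbow) ← rainbow-exists (≤-trans (*-monoʳ-≤ 7 (n≤1+n m)) large)
                           (ℓ ∘ suc) (r ∘ suc) (λ i → ℓ-inj (suc i)) (λ i → r-inj (suc i))
  = decidable-stable (rainbow? ℓ r) λ stuck →
      Augmentation.impossible ℓ r ℓ-inj r-inj c c-rainbow stuck large

-- Reduction to kt vertices on each side.

rows : ∀ {A : Set} → Vec A (k * t) → Fin k → Fin t → A
rows v i p = lookup v (combine i p)

CompactForcesRainbow : ℕ → ℕ → Set
CompactForcesRainbow k t = (v w : Vec (Fin (k * t)) (k * t)) → let ℓ = rows {k} v; r = rows {k} w in
  RowInjective ℓ → RowInjective r → Rainbow ℓ r

compactForcesRainbow? : ∀ k t → Dec (CompactForcesRainbow k t)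
compactForcesRainbow? k t = ∀-dec searchV λ v → ∀-dec searchV λ w →
  rowInjective? (rows v) →-dec (rowInjective? (rows w) →-dec rainbow? (rows {k} v) (rows w))
  where
  searchV : Searchable (Vec (Fin (k * t)) (k * t))
  searchV = search-Vec any? (k * t)
  rowInjective? : (ℓ : Ends k t (k * t)) → Dec (RowInjective ℓ)
  rowInjective? ℓ = all? (injective? ∘ ℓ)

-- The index of the first position where `g` takes the value `g a`: a canonical label that lives in
-- `Fin m` whatever the size of the codomain.
relabel : (Fin m → Fin n) → Fin m → Fin m
relabel g zero    = zero
relabel g (suc a) with g zero ≟ g (suc a)
... | yes _ = zero
... | no  _ = suc (relabel (g ∘ suc) a)

relabel-cong : (g : Fin m → Fin n) → ∀ a b → g a ≡ g b → relabel g a ≡ relabel g b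
relabel-cong g zero    zero    eq = refl
relabel-cong g zero    (suc b) eq with g zero ≟ g (suc b)
... | yes _ = refl
... | no ne = contradiction eq ne
relabel-cong g (suc a) zero    eq with g zero ≟ g (suc a)
... | yes _ = refl
... | no ne = contradiction (sym eq) ne
relabel-cong g (suc a) (suc b) eq with g zero ≟ g (suc a) | g zero ≟ g (suc b)
... | yes _  | yes _  = refl
... | yes e  | no ne  = contradiction (trans e eq) ne
... | no ne  | yes e  = contradiction (trans e (sym eq)) ne
... | no _   | no _   = cong suc (relabel-cong (g ∘ suc) a b eq)

relabel-reflects : (g : Fin m → Fin n) → ∀ a b → relabel g a ≡ relabel g b → g a ≡ g b
relabel-reflects g zero    zero    eq = refl
relabel-reflects g zero    (suc b) eq with g zero ≟ g (suc b)
... | yes e = e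
relabel-reflects g (suc a) zero    eq with g zero ≟ g (suc a)
... | yes e = sym e
relabel-reflects g (suc a) (suc b) eq with g zero ≟ g (suc a) | g zero ≟ g (suc b)
... | yes e | yes e′ = trans (sym e) e′
... | no _  | no _   = relabel-reflects (g ∘ suc) a b (suc-injective eq)

-- Row injectivity and being rainbow depend only on which ends coincide, and relabelling each side
-- preserves and reflects coincidence.
compact⇒rainbow : CompactForcesRainbow k t → (ℓ r : Ends k t n) → RowInjective ℓ → RowInjective r → Rainbow ℓ r
compact⇒rainbow {k} {t} compact ℓ r ℓ-inj r-inj =
  let (c , ℓ-ok , r-ok) = compact (compress ℓ) (compress r) (compress-inj ℓ ℓ-inj) (compress-inj r r-inj)
  in c , compress-rainbow ℓ ℓ-ok , compress-rainbow r r-ok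
  where
  module _ {n} (ε : Ends k t n) where
    flat : Fin (k * t) → Fin n
    flat a = let (i , p) = remQuot {k} t a in ε i p

    flat-combine : ∀ i p → flat (combine i p) ≡ ε i p
    flat-combine i p = cong (λ (i , p) → ε i p) (remQuot-combine {k} i p)

    compress : Vec (Fin (k * t)) (k * t)
    compress = tabulate (relabel flat)

    compress-≡ : ∀ i p → rows compress i p ≡ relabel flat (combine i p)
    compress-≡ i p = lookup∘tabulate (relabel flat) (combine i p)

    compress-inj : RowInjective ε → RowInjective (rows {k} compress)
    compress-inj ε-inj i {p} {q} eq = ε-inj i (begin
      ε i p                  ≡⟨ flat-combine i p ⟨
      flat (combine i p)     ≡⟨ relabel-reflects flat _ _ (trans (sym (compress-≡ i p)) (trans eq (compress-≡ i q))) ⟩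
      flat (combine i q)     ≡⟨ flat-combine i q ⟩
      ε i q                  ∎)
      where open ≡-Reasoning

    compress-rainbow : ∀ {c} → Injective _≡_ _≡_ (along (rows compress) c) → Injective _≡_ _≡_ (along ε c)
    compress-rainbow {c} inj {i} {j} eq = inj (begin
      rows compress i (c i)                ≡⟨ compress-≡ i (c i) ⟩
      relabel flat (combine i (c i))       ≡⟨ relabel-cong flat _ _ (trans (flat-combine i (c i)) (trans eq (sym (flat-combine j (c j))))) ⟩
      relabel flat (combine j (c j))       ≡⟨ compress-≡ j (c j) ⟨
      rows compress j (c j)                ∎)
      where open ≡-Reasoning

-- Passing between hypergraphs and families of ends.

allPairs-lookup : ∀ {A : Set} {R : A → A → Set} → Symmetric R → ∀ {xs} → AllPairs R xs →
                  ∀ {a b} → a ≢ b → R (List.lookup xs a) (List.lookup xs b)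
allPairs-lookup R-sym (Rx ∷ Rxs) {zero}  {zero}  a≢b = contradiction refl a≢b
allPairs-lookup R-sym (Rx ∷ Rxs) {zero}  {suc b} a≢b = All.lookup Rx (∈-lookup b)
allPairs-lookup R-sym (Rx ∷ Rxs) {suc a} {zero}  a≢b = R-sym (All.lookup Rx (∈-lookup a))
allPairs-lookup R-sym (Rx ∷ Rxs) {suc a} {suc b} a≢b = allPairs-lookup R-sym Rxs (a≢b ∘ cong suc)

disjoint-sym : Symmetric (Disjoint {n})
disjoint-sym {x = e} {e′} disj (v , v∈) = disj (v , x∈p∩q⁺ (swap (x∈p∩q⁻ e′ e v∈)))

module FromHypergraph (H : PartiteHypergraph 2) (F : Fin k → List (Subset (order H)))
                      (matching : ∀ i → IsMatchingOfSize H t (F i)) where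

  open IsMatchingOfSize

  position : ∀ i → Fin t → Fin (length (F i))
  position i = cast (sym (size (matching i)))

  edge : Fin k → Fin t → Subset (order H)
  edge i p = List.lookup (F i) (position i p)

  edge∈ : ∀ i p → edge i p ∈ˡ F i
  edge∈ i p = ∈-lookup (position i p)

  end-of : ∀ i p (s : Fin 2) → ∃! _≡_ (λ v → v ∈ edge i p × side H v ≡ s)
  end-of i p = All.lookup (partite H) (inEdges (matching i) (edge∈ i p))

  end : Fin 2 → Ends k t (order H)
  end s i p = proj₁ (end-of i p s)

  end-∈ : ∀ s i p → end s i p ∈ edge i p
  end-∈ s i p = proj₁ (proj₁ (proj₂ (end-of i p s)))

  end-unique : ∀ {v i p} → v ∈ edge i p → end (side H v) i p ≡ v
  end-unique {v} {i} {p} v∈ = proj₂ (proj₂ (end-of i p (side H v))) (v∈ , refl)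

  end-injective : ∀ s → RowInjective (end s)
  end-injective s i {p} {q} eq = decidable-stable (p ≟ q) λ p≢q →
    allPairs-lookup disjoint-sym (disjoint (matching i)) (p≢q ∘ position-injective)
      (end s i p , x∈p∩q⁺ (end-∈ s i p , subst (_∈ edge i q) (sym eq) (end-∈ s i q)))
    where
    position-injective : position i p ≡ position i q → p ≡ q
    position-injective eq = toℕ-injective (trans (sym (toℕ-cast _ p)) (trans (cong toℕ eq) (toℕ-cast _ q)))

  -- A shared vertex would be the end of both edges on its own side, against injectivity there.
  rainbowMatching : Rainbow (end zero) (end (suc zero)) → RainbowMatching F
  rainbowMatching (c , ok₀ , ok₁) = record
    { choice   = λ i → edge i (c i)
    ; chosen   = λ i → edge∈ i (c i)
    ; disjoint = λ {i} {j} i≢j (v , v∈) →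
        let (v∈i , v∈j) = x∈p∩q⁻ (edge i (c i)) (edge j (c j)) v∈
        in i≢j (ok (side H v) (trans (end-unique v∈i) (sym (end-unique v∈j))))
    }
    where
    ok : ∀ s → Injective _≡_ _≡_ (along (end s) c)
    ok zero       = ok₀
    ok (suc zero) = ok₁

module ToHypergraph (ℓ r : Ends k t n) (ℓ-inj : RowInjective ℓ) (r-inj : RowInjective r) where

  sideOf : Fin (n + n) → Fin 2
  sideOf v = [ const zero , const (suc zero) ]′ (splitAt n v)

  end : Fin 2 → Ends k t (n + n)
  end zero    i p = ℓ i p ↑ˡ n
  end (suc _) i p = n ↑ʳ r i p

  end-injective : ∀ s → RowInjective (end s)
  end-injective zero       i eq = ℓ-inj i (↑ˡ-injective n _ _ eq)
  end-injective (suc zero) i eq = r-inj i (↑ʳ-injective n _ _ eq)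

  end-side : ∀ s i p → sideOf (end s i p) ≡ s
  end-side zero       i p = cong [ _ , _ ]′ (splitAt-↑ˡ n (ℓ i p) n)
  end-side (suc zero) i p = cong [ _ , _ ]′ (splitAt-↑ʳ n n (r i p))

  edge : Fin k → Fin t → Subset (n + n)
  edge i p = ⁅ end zero i p ⁆ ∪ ⁅ end (suc zero) i p ⁆

  end-∈ : ∀ s i p → end s i p ∈ edge i p
  end-∈ zero       i p = x∈p∪q⁺ (inj₁ (x∈⁅x⁆ _))
  end-∈ (suc zero) i p = x∈p∪q⁺ {p = ⁅ end zero i p ⁆} (inj₂ (x∈⁅x⁆ _))

  end-unique : ∀ {v} i p → v ∈ edge i p → end (sideOf v) i p ≡ v
  end-unique {v} i p v∈ = [ at zero , at (suc zero) ]′ (x∈p∪q⁻ ⁅ end zero i p ⁆ _ v∈)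
    where
    at : ∀ s → v ∈ ⁅ end s i p ⁆ → end (sideOf v) i p ≡ v
    at s v∈s with refl ← x∈⁅y⁆⇒x≡y (end s i p) v∈s = cong (λ s → end s i p) (end-side s i p)

  hypergraph : PartiteHypergraph 2
  hypergraph = record
    { order   = n + n
    ; side    = sideOf
    ; edges   = tabulateˡ (uncurry edge ∘ remQuot {k} t)
    ; partite = All.tabulate⁺ λ a → let (i , p) = remQuot {k} t a in λ s →
        end s i p , (end-∈ s i p , end-side s i p) , λ { (v∈ , refl) → end-unique i p v∈ }
    }

  family : Fin k → List (Subset (n + n))
  family i = tabulateˡ (edge i)

  edge-disjoint : ∀ i {p q} → p ≢ q → Disjoint (edge i p) (edge i q)
  edge-disjoint i {p} {q} p≢q (v , v∈) =
    let (v∈p , v∈q) = x∈p∩q⁻ (edge i p) (edge i q) v∈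
    in p≢q (end-injective (sideOf v) i (trans (end-unique i p v∈p) (sym (end-unique i q v∈q))))

  isMatching : ∀ i → IsMatchingOfSize hypergraph t (family i)
  isMatching i = record
    { inEdges  = λ e∈ → let (p , e≡) = ∈-tabulate⁻ e∈ in
        subst (_∈ˡ edges hypergraph) (trans (cong (uncurry edge) (remQuot-combine i p)) (sym e≡))
          (∈-tabulate⁺ (combine i p))
    -- An edge contains its left end, so it is not disjoint from itself; disjoint edges are
    -- therefore distinct.
    ; unique   = AllPairs.tabulate⁺ λ {p} {q} p≢q eq → edge-disjoint i p≢q
        (end zero i p , x∈p∩q⁺ (end-∈ zero i p , subst (end zero i p ∈_) eq (end-∈ zero i p)))
    ; disjoint = AllPairs.tabulate⁺ (edge-disjoint i)
    ; size     = length-tabulate (edge i)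
    }

  rainbow : RainbowMatching family → Rainbow ℓ r
  rainbow M = c , (λ eq → ok zero (cong (_↑ˡ n) eq)) , (λ eq → ok (suc zero) (cong (n ↑ʳ_) eq))
    where
    open RainbowMatching M
    c : Fin k → Fin t
    c i = proj₁ (∈-tabulate⁻ (chosen i))

    end-∈-choice : ∀ s i → end s i (c i) ∈ choice i
    end-∈-choice s i = subst (end s i (c i) ∈_) (sym (proj₂ (∈-tabulate⁻ (chosen i)))) (end-∈ s i (c i))

    ok : ∀ s → Injective _≡_ _≡_ (along (end s) c)
    ok s {i} {j} eq = decidable-stable (i ≟ j) λ i≢j → disjoint i≢j
      (end s i (c i) , x∈p∩q⁺ (end-∈-choice s i , subst (_∈ choice j) (sym eq) (end-∈-choice s j)))

-- The least forcing size.

-- The quantifier over all hypergraphs is replaced by the equivalent finite condition.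
-- `ToHypergraph` turns a compact counterexample into a genuine one.
forcesRainbow? : ∀ k t → Dec (ForcesRainbow 2 k t)
forcesRainbow? k t = map′
  (λ compact H F matching → let open FromHypergraph H F matching in
    rainbowMatching (compact⇒rainbow compact _ _ (end-injective zero) (end-injective (suc zero))))
  (λ forces v w ℓ-inj r-inj → let open ToHypergraph (rows v) (rows w) ℓ-inj r-inj in
    rainbow (forces hypergraph family isMatching))
  (compactForcesRainbow? k t)

forcesRainbow : 7 * k ≤ 4 * t + 3 → ForcesRainbow 2 k t
forcesRainbow large H F matching = rainbowMatching
  (rainbow-exists large _ _ (end-injective zero) (end-injective (suc zero)))
  where open FromHypergraph H F matching

least-below : {P : ℕ → Set} → Decidable P → ∀ b → (∃ λ t → IsLeast P t × t < b) ⊎ (∀ {s} → s < b → ¬ P s)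
least-below P? zero = inj₂ λ ()
least-below P? (suc b) with least-below P? b | P? b
... | inj₁ (t , least , t<b) | _      = inj₁ (t , least , m≤n⇒m≤1+n t<b)
... | inj₂ none              | yes Pb = inj₁ (b , (Pb , λ s Ps → ≮⇒≥ λ s<b → none s<b Ps) , ≤-refl)
... | inj₂ none              | no ¬Pb = inj₂ λ s<1+b Ps →
  [ (λ s<b → none s<b Ps) , (λ { refl → ¬Pb Ps }) ]′ (m≤n⇒m<n∨m≡n (≤-pred s<1+b))

least-≤ : {P : ℕ → Set} → Decidable P → ∀ {b} → P b → ∃ λ t → IsLeast P t × t ≤ b
least-≤ P? {b} Pb with least-below P? (suc b)
... | inj₁ (t , least , t<1+b) = t , least , ≤-pred t<1+b
... | inj₂ none                = contradiction Pb (none ≤-refl)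

m≤n*[m/n]+[n∸1] : ∀ m n .{{_ : NonZero n}} → m ≤ n * (m / n) + pred n
m≤n*[m/n]+[n∸1] m n = begin
  m                      ≡⟨ m≡m%n+[m/n]*n m n ⟩
  m % n + m / n * n      ≤⟨ +-monoˡ-≤ _ (<⇒≤pred (m%n<n m n)) ⟩
  pred n + m / n * n     ≡⟨ +-comm (pred n) _ ⟩
  m / n * n + pred n     ≡⟨ cong (_+ pred n) (*-comm (m / n) n) ⟩
  n * (m / n) + pred n   ∎
  where open ≤-Reasoning

theorem1p12 : ∀ (k : ℕ) → 1 ≤ k → ∃ λ t → f[ 2 , k ]≡ t × 4 * t ≤ 7 * k
theorem1p12 k _ =
  -- The least size to which `forcesRainbow` applies: the remainder modulo 4 is at most 3, so 7k ≤
  -- 4q + 3.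
  let q                 = 7 * k / 4
      (t , least , t≤q) = least-≤ (forcesRainbow? k) {q} (forcesRainbow (m≤n*[m/n]+[n∸1] (7 * k) 4))
  in t , least , (begin
    4 * t    ≤⟨ *-monoʳ-≤ 4 t≤q ⟩
    4 * q    ≡⟨ *-comm 4 q ⟩
    q * 4    ≤⟨ m/n*n≤m (7 * k) 4 ⟩
    7 * k    ∎)
  where open ≤-Reasoning
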